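{- For all graphs $G$ and $H$, $$\operatorname{tw}(G\,\square\, H)\geq \operatorname{sbn}(G)(\operatorname{tw}(H)+1)-1.$$
   Context: All graphs are simple, finite and undirected. A tree-decomposition of a graph $G$ is a pair $(T,\beta)$ consisting of a tree $T$ and a function $\beta:V(T)\to 2^{V(G)}$ such that (i) for every $v\in V(G)$, the set $\{t\in V(T): v\in\beta(t)\}$ is non-empty and induces a connected subgraph of $T$; and (ii) for every edge $uv\in E(G)$ there is $t\in V(T)$ with $\{u,v\}\subseteq\beta(t)$. Its width is $\max_{t\in V(T)}|\beta(t)|-1$. The treewidth $\operatorname{tw}(G)$ is the minimum width of a tree-decomposition of $G$. A set $A\subseteq V(G)$ is connected in $G$ if the induced subgraph $G[A]$ is connected. A strict bramble in $G$ is a collection $\mathscr{S}$ of non-empty connected subsets of $V(G)$ that pairwise intersect. A hitting set for $\mathscr{S}$ is a set $S\subseteq V(G)$ that intersects every element of $\mathscr{S}$; the order of $\mathscr{S}$ is the minimum size of a hitting set for $\mathscr{S}$. The strict bramble number $\operatorname{sbn}(G)$ is the maximum order of a strict bramble in $G$. The Cartesian product $G\,\square\, H$ is the graph with vertex set $V(G)\times V(H)$, where $(g_1,h_1)(g_2,h_2)$ is an edge if and only if $g_1=g_2$ and $h_1h_2\in E(H)$; or $g_1g_2\in E(G)$ and $h_1=h_2$. -}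

module Defs where

open import Data.Fin.Base using (Fin; remQuot)
open import Data.Fin.Properties using (_≟_)
open import Data.Fin.Subset using (Subset; _∈_; _∩_; Nonempty; ∣_∣)
open import Data.Integer.Base as ℤ using (ℤ; +_; 1ℤ)
open import Data.List.Base using (List; _∷_; _∷ʳ_; length; tabulate)
open import Data.List.Extrema.Nat using (max)
import Data.List.Membership.Propositional as List
open import Data.List.Relation.Unary.Linked using (Linked)
open import Data.List.Relation.Unary.Unique.Propositional using (Unique)
open import Data.Nat.Base as ℕ using (ℕ)
open import Data.Product.Base using (_×_; _,_; ∃-syntax)
open import Data.Sum.Base as Sum using (_⊎_; inj₁; inj₂)
open import Level using (0ℓ)
open import Relation.Binary.Construct.Closure.ReflexiveTransitive using (Star)
open import Relation.Binary.Core using (Rel)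
open import Relation.Binary.Definitions using (Decidable; Symmetric)
open import Relation.Binary.PropositionalEquality using (_≡_; sym)
open import Relation.Nullary.Decidable using (_×-dec_; _⊎-dec_)
open import Relation.Nullary.Negation using (¬_)
open import Relation.Unary using (Pred; U)

record Graph : Set₁ where
  field
    order      : ℕ
    Adj        : Rel (Fin order) 0ℓ
    adj?       : Decidable Adj
    adj-sym    : Symmetric Adj
    adj-irrefl : ∀ {v} → ¬ Adj v v

  Vertex : Set
  Vertex = Fin order

  VertexSet : Set
  VertexSet = Subset order

open Graph

-- The edges of G[P].  Its vertices are those of P, so that a walk in G[P]
-- is a walk along these edges between elements of P.
InducedAdj : (G : Graph) → Pred (Vertex G) 0ℓ → Rel (Vertex G) 0ℓ
InducedAdj G P u v = P u × P v × Adj G u v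

-- The empty set counts as connected; non-emptiness is required separately
-- wherever it matters.
Connected : (G : Graph) → Pred (Vertex G) 0ℓ → Set
Connected G P = ∀ {u v} → P u → P v → Star (InducedAdj G P) u v

-- v ∷ vs lists the vertices of a cycle in cyclic order, each exactly once.
record IsCycle (G : Graph) (v : Vertex G) (vs : List (Vertex G)) : Set where
  field
    length≥3 : 3 ℕ.≤ length (v ∷ vs)
    distinct : Unique (v ∷ vs)
    closed   : Linked (Adj G) ((v ∷ vs) ∷ʳ v)

record IsTree (T : Graph) : Set where
  field
    nonempty  : Vertex T
    connected : Connected T U
    acyclic   : ∀ {v vs} → ¬ IsCycle T v vs

record TreeDecomposition (G : Graph) : Set₁ where
  field
    tree             : Graph
    isTree           : IsTree tree
    bag              : Vertex tree → VertexSet G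
    vertex-covered   : ∀ v → ∃[ t ] v ∈ bag t
    vertex-connected : ∀ v → Connected tree (λ t → v ∈ bag t)
    edge-covered     : ∀ {u v} → Adj G u v → ∃[ t ] (u ∈ bag t × v ∈ bag t)

  -- Integer-valued: the graph with no vertices has width -1.
  width : ℤ
  width = + max 0 (tabulate (λ t → ∣ bag t ∣)) ℤ.- 1ℤ

open TreeDecomposition using (width)

IsMinimum : ∀ {a ℓ p} {A : Set a} → Rel A ℓ → Pred A p → Pred A _
IsMinimum _≤_ P m = P m × (∀ {x} → P x → m ≤ x)

IsMaximum : ∀ {a ℓ p} {A : Set a} → Rel A ℓ → Pred A p → Pred A _
IsMaximum _≤_ P m = P m × (∀ {x} → P x → x ≤ m)

-- Extremal invariants are given as relations: IsTreewidth G k says tw(G) = k.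
IsTreewidth : Graph → ℤ → Set₁
IsTreewidth G = IsMinimum ℤ._≤_ (λ k → ∃[ D ] width {G} D ≡ k)

-- The list stands for the finite set of its entries.
record StrictBramble (G : Graph) : Set where
  field
    sets      : List (VertexSet G)
    nonempty  : ∀ {A} → A List.∈ sets → Nonempty A
    connected : ∀ {A} → A List.∈ sets → Connected G (_∈ A)
    intersect : ∀ {A B} → A List.∈ sets → B List.∈ sets → Nonempty (A ∩ B)

IsHittingSet : ∀ {G} → StrictBramble G → VertexSet G → Set
IsHittingSet 𝒮 S = ∀ {A} → A List.∈ StrictBramble.sets 𝒮 → Nonempty (S ∩ A)

IsBrambleOrder : ∀ {G} → StrictBramble G → ℕ → Set
IsBrambleOrder 𝒮 = IsMinimum ℕ._≤_ (λ k → ∃[ S ] (IsHittingSet 𝒮 S × ∣ S ∣ ≡ k))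

IsStrictBrambleNumber : Graph → ℕ → Set
IsStrictBrambleNumber G =
  IsMaximum ℕ._≤_ (λ k → ∃[ 𝒮 ] IsBrambleOrder {G} 𝒮 k)

-- The vertex (g , h) is encoded as combine g h : Fin (order G * order H),
-- which remQuot decodes.
infixr 7 _□_
_□_ : Graph → Graph → Graph
G □ H = record
  { order      = order G ℕ.* order H
  ; Adj        = λ p q → PairAdj (decode p) (decode q)
  ; adj?       = λ p q → pairAdj? (decode p) (decode q)
  ; adj-sym    = Sum.map
      (λ (g≡ , h~) → sym g≡ , adj-sym H h~)
      (λ (g~ , h≡) → adj-sym G g~ , sym h≡)
  ; adj-irrefl = λ where
      (inj₁ (_ , h~h)) → adj-irrefl H h~h
      (inj₂ (g~g , _)) → adj-irrefl G g~g
  }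
  where
  decode : Fin (order G ℕ.* order H) → Vertex G × Vertex H
  decode = remQuot (order H)

  PairAdj : Rel (Vertex G × Vertex H) 0ℓ
  PairAdj (g₁ , h₁) (g₂ , h₂) =
    (g₁ ≡ g₂ × Adj H h₁ h₂) ⊎ (Adj G g₁ g₂ × h₁ ≡ h₂)

  pairAdj? : Decidable PairAdj
  pairAdj? (g₁ , h₁) (g₂ , h₂) =
    ((g₁ ≟ g₂) ×-dec adj? H h₁ h₂) ⊎-dec (adj? G g₁ g₂ ×-dec (h₁ ≟ h₂))

{-# OPTIONS --safe #-}

-- Let 𝒮 be a strict bramble of order s in G and (T , β) a tree-decomposition
-- of G □ H.  Put h into β′(t) when { g : (g , h) ∈ β(t) } hits 𝒮; then
-- ∣ β(t) ∣ ≥ s ∣ β′(t) ∣, so it suffices that (T , β′) decomposes H.  For A ∈ 𝒮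
-- the nodes whose bag meets A × {h} form a subtree of T.  If h and h′ are equal
-- or adjacent, then the subtrees of A × {h} and B × {h′} intersect, because
-- some g ∈ A ∩ B has (g , h) and (g , h′) in a common bag.  By the Helly
-- property of subtrees the subtrees of all A × {h} and A × {h′} share a node,
-- and an intersection of subtrees is connected.  Both facts about subtrees come
-- down to one: the two ends of an edge of a tree are not joined by a walk that
-- avoids this edge.
module Submission where

open import Data.Bool.Base using (Bool; true; false; if_then_else_)
open import Data.Fin.Base using (Fin; zero; suc; combine; remQuot; _↑ˡ_; _↑ʳ_)
open import Data.Fin.Properties using (_≟_; any?; remQuot-combine)
open import Data.Fin.Subset using (Subset; _∈_; ∣_∣)
open import Data.Fin.Subset.Properties using (_∈?_; x∈p∩q⁺; x∈p∩q⁻)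
open import Data.Integer.Base using (ℤ; +_; 1ℤ; _+_; _-_; _*_; _≥_)
import Data.Integer.Base as ℤ
import Data.Integer.Properties as ℤ
open import Data.List.Base using (List; []; _∷_; _∷ʳ_; cartesianProduct; tabulate)
open import Data.List.Extrema.Nat using (argmax-all; max; xs≤max)
open import Data.List.Membership.DecPropositional using () renaming (_∈?_ to member?)
import Data.List.Membership.Propositional as List
open import Data.List.Membership.Propositional.Properties
  using (∈-cartesianProduct⁺; ∈-cartesianProduct⁻)
open import Data.List.Relation.Unary.All as All using (All; []; _∷_)
import Data.List.Relation.Unary.All.Properties as All
open import Data.List.Relation.Unary.Any using (here; there)
open import Data.List.Relation.Unary.AllPairs using ([]; _∷_)
open import Data.List.Relation.Unary.Linked using (Linked; [-]; _∷_)
open import Data.List.Relation.Unary.Unique.Propositional using (Unique)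
open import Data.Nat.Base as ℕ using (ℕ; zero; suc; z≤n; s≤s)
import Data.Nat.Properties as ℕ
open import Algebra.Properties.Semiring.Sum ℕ.+-*-semiring
  using (sum; sum-syntax; sum-cong-≗; ∑-comm; *-distribˡ-sum)
open import Data.Product.Base using (_×_; _,_; ∃-syntax; proj₁; proj₂)
open import Data.Sum.Base using (_⊎_; inj₁; inj₂)
open import Data.Unit.Base using (tt)
import Data.Vec.Base as Vec
open import Data.Vec.Properties using ([]=⇒lookup; lookup⇒[]=; lookup∘tabulate)
open import Function.Base using (_∘_; id)
open import Level using (0ℓ)
open import Relation.Binary.Core using (Rel; _⇒_)
open import Relation.Binary.Construct.Closure.ReflexiveTransitive as Star
  using (Star; ε; _◅_; _◅◅_)
open import Relation.Binary.PropositionalEquality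
  using (_≡_; _≢_; refl; sym; trans; cong; subst; subst₂)
open import Relation.Nullary.Decidable using (yes; no; does; _×-dec_; dec-true)
open import Relation.Nullary.Negation using (¬_; contradiction)
open import Relation.Unary using (Pred; Decidable; U; _∩_)
open import Defs

open Graph

-- Simple paths

-- The list holds the vertices after the first one.
data Path {n} (R : Rel (Fin n) 0ℓ) : Fin n → Fin n → List (Fin n) → Set where
  []   : ∀ {x} → Path R x x []
  step : ∀ {x x′ y vs} → R x x′ → x List.∉ (x′ ∷ vs) → Path R x′ y vs →
         Path R x y (x′ ∷ vs)

module _ {n} {R : Rel (Fin n) 0ℓ} where

  dropUntil : ∀ {x y z vs} → Path R x y vs → z List.∈ (x ∷ vs) → ∃[ ws ] Path R z y ws
  dropUntil p            (here refl) = _ , p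
  dropUntil (step _ _ p) (there z∈)  = dropUntil p z∈

  -- Loop erasure: if `x` already lies on the path built from its successor, everything before that
  -- occurrence is cut off.
  simplePath : ∀ {x y} → Star R x y → ∃[ vs ] Path R x y vs
  simplePath ε = _ , []
  simplePath {x} (e ◅ es) with simplePath es
  ... | vs , p with member? _≟_ x (_ ∷ vs)
  ...   | yes x∈ = dropUntil p x∈
  ...   | no  x∉ = _ , step e x∉ p

  path-unique : ∀ {x y vs} → Path R x y vs → Unique (x ∷ vs)
  path-unique []            = [] ∷ []
  path-unique (step _ x∉ p) = All.¬Any⇒All¬ _ x∉ ∷ path-unique p

  path-linked : ∀ {S : Rel (Fin n) 0ℓ} {x y z vs} → R ⇒ S → Path R x y vs → S y z →
                Linked S ((x ∷ vs) ∷ʳ z)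
  path-linked R⇒S []           Syz = Syz ∷ [-]
  path-linked R⇒S (step e _ p) Syz = R⇒S e ∷ path-linked R⇒S p Syz

  path-avoids : ∀ {x y z vs} → z List.∉ (x ∷ vs) → Path R x y vs →
                Star (λ p q → R p q × q ≢ z) x y
  path-avoids z∉ []           = ε
  path-avoids z∉ (step e _ p) =
    (e , λ { refl → z∉ (there (here refl)) }) ◅ path-avoids (z∉ ∘ there) p

-- Subtrees

-- In a tree this amounts to connectedness for decidable `P`, but in this form it passes to
-- intersections pointwise.
Convex : (T : Graph) → Pred (Vertex T) 0ℓ → Set
Convex T P = ∀ {x y vs} → Path (Adj T) x y vs → P x → P y → All P (x ∷ vs)

induced-walk : ∀ T {P x y vs} → Path (Adj T) x y vs → All P (x ∷ vs) →
               Star (InducedAdj T P) x y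
induced-walk T []           _              = ε
induced-walk T (step e _ p) (px ∷ px′ ∷ ps) = (px , px′ , e) ◅ induced-walk T p (px′ ∷ ps)

module _ {T : Graph} (isTree : IsTree T) where
  open IsTree isTree

  tree-path : ∀ x y → ∃[ vs ] Path (Adj T) x y vs
  tree-path x y = simplePath (Star.map (proj₂ ∘ proj₂) (connected tt tt))

  -- After loop erasure, a path of at least two steps closes up to a cycle with the edge `u v`, and
  -- a single step would be the barred one. The reverse step may stay allowed.
  bridge : ∀ {u v} → Adj T u v → ¬ Star (λ p q → Adj T p q × (p ≢ u ⊎ q ≢ v)) u v
  bridge {u} {v} u~v w with simplePath w
  ... | _ , []                            = adj-irrefl T u~v
  ... | _ , step (_ , inj₁ u≢u) _ []      = u≢u refl
  ... | _ , step (_ , inj₂ v≢v) _ []      = v≢v refl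
  ... | _ , p@(step _ _ (step _ _ _))     = acyclic record
    { length≥3 = s≤s (s≤s (s≤s z≤n))
    ; distinct = path-unique p
    ; closed   = path-linked proj₁ p (adj-sym T u~v)
    }

  -- The first walk never enters `x` and the second never leaves `x′`, so their concatenation never
  -- steps from `x′` to `x`, against `bridge`.
  no-detour : ∀ {x x′ y} → Adj T x x′ →
              Star (λ p q → Adj T p q × q ≢ x) x′ y →
              ¬ Star (λ p q → Adj T p q × p ≢ x′) y x
  no-detour x~x′ x′⇝y y⇝x = bridge (adj-sym T x~x′)
    (Star.map (λ (e , q≢) → e , inj₂ q≢) x′⇝y ◅◅ Star.map (λ (e , p≢) → e , inj₁ p≢) y⇝x)

  missed-as-target : ∀ {P : Pred (Vertex T) 0ℓ} {x y z} → ¬ P z → Star (InducedAdj T P) x y →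
                     Star (λ p q → Adj T p q × q ≢ z) x y
  missed-as-target ¬Pz = Star.map λ (_ , Pq , e) → e , λ { refl → ¬Pz Pq }

  missed-as-source : ∀ {P : Pred (Vertex T) 0ℓ} {x y z} → ¬ P z → Star (InducedAdj T P) x y →
                     Star (λ p q → Adj T p q × p ≢ z) x y
  missed-as-source ¬Pz = Star.map λ (Pp , _ , e) → e , λ { refl → ¬Pz Pp }

  -- If the path left P at x′, its remainder and a walk in P back to x would
  -- bypass the edge x x′.
  connected⇒convex : ∀ {P} → Decidable P → Connected T P → Convex T P
  connected⇒convex P? conn [] Px Py = Px ∷ []
  connected⇒convex P? conn (step {x′ = x′} e x∉ p) Px Py with P? x′
  ... | yes Px′ = Px ∷ connected⇒convex P? conn p Px′ Py
  ... | no ¬Px′ =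
    contradiction (missed-as-source ¬Px′ (conn Py Px)) (no-detour e (path-avoids x∉ p))

  convex⇒connected : ∀ {P} → Convex T P → Connected T P
  convex⇒connected conv Px Py with tree-path _ _
  ... | _ , p = induced-walk T p (conv p Px Py)

  ∩-convex : ∀ {P Q} → Convex T P → Convex T Q → Convex T (P ∩ Q)
  ∩-convex convP convQ p (Px , Qx) (Py , Qy) = All.zip (convP p Px Py , convQ p Qx Qy)

  -- If the path stepped from A ∖ B to x′ ∉ A, its remainder and walks in B to c
  -- and in A back to x would bypass the edge x x′.
  path-meets-both : ∀ {A B x y c vs} → Decidable A → Decidable B →
                    Connected T A → Connected T B → A c → B c →
                    Path (Adj T) x y vs → A x → B y → ∃[ z ] (z List.∈ (x ∷ vs) × A z × B z)
  path-meets-both A? B? connA connB Ac Bc [] Ax Bx = _ , here refl , Ax , Bx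
  path-meets-both A? B? connA connB Ac Bc (step {x = x} {x′ = x′} e x∉ p) Ax By
    with B? x | A? x′
  ... | yes Bx | _       = x , here refl , Ax , Bx
  ... | no _   | yes Ax′ =
    let z , z∈ , ABz = path-meets-both A? B? connA connB Ac Bc p Ax′ By in z , there z∈ , ABz
  ... | no ¬Bx | no ¬Ax′ = contradiction (missed-as-source ¬Ax′ (connA Ac Ax))
    (no-detour e (path-avoids x∉ p ◅◅ missed-as-target ¬Bx (connB By Bc)))

  -- The path from a node of A ∩ C to one of B ∩ C stays in C by convexity and contains a node of A
  -- ∩ B by `path-meets-both`.
  helly₃ : ∀ {A B C} → Decidable A → Decidable B → Connected T A → Connected T B → Convex T C →
           ∃[ v ] (A v × B v) → ∃[ v ] (A v × C v) → ∃[ v ] (B v × C v) →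
           ∃[ v ] (A v × B v × C v)
  helly₃ A? B? connA connB convC (c , Ac , Bc) (b , Ab , Cb) (a , Ba , Ca)
    with tree-path _ _
  ... | _ , p with path-meets-both A? B? connA connB Ac Bc p Ab Ba
  ...   | z , z∈ , Az , Bz = z , Az , Bz , All.lookup (convC p Cb Ca) z∈

  module _ {I : Set} {P : I → Pred (Vertex T) 0ℓ} (P? : ∀ i → Decidable (P i)) where

    -- `Q` accumulates the intersection of the subtrees treated so far. When `P i` joins it,
    -- `helly₃` shows that the smaller `Q` still meets each remaining subtree.
    helly : ∀ {Q} → Decidable Q → Convex T Q → ∃[ v ] Q v → (is : List I) →
            (∀ {i} → i List.∈ is → Convex T (P i)) →
            (∀ {i} → i List.∈ is → ∃[ v ] (Q v × P i v)) →
            (∀ {i j} → i List.∈ is → j List.∈ is → ∃[ v ] (P i v × P j v)) →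
            ∃[ v ] (Q v × All (λ i → P i v) is)
    helly Q? convQ (v , Qv) []       convP QP PP = v , Qv , []
    helly Q? convQ _        (i ∷ is) convP QP PP
      with helly (λ v → Q? v ×-dec P? i v) (∩-convex convQ (convP (here refl)))
             (QP (here refl)) is (convP ∘ there)
             (λ j∈ → let v , Qv , Piv , Pjv = helly₃ Q? (P? i) (convex⇒connected convQ)
                           (convex⇒connected (convP (here refl))) (convP (there j∈))
                           (QP (here refl)) (QP (there j∈)) (PP (here refl) (there j∈))
                     in v , (Qv , Piv) , Pjv)
             (λ i∈ j∈ → PP (there i∈) (there j∈))
    ... | v , (Qv , Piv) , Pisv = v , Qv , Piv ∷ Pisv

-- Cardinalities

module _ {n} {P : Pred (Fin n) 0ℓ} (P? : Decidable P) where

  comprehension : Subset n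
  comprehension = Vec.tabulate (does ∘ P?)

  ∈-comprehension⁺ : ∀ {i} → P i → i ∈ comprehension
  ∈-comprehension⁺ {i} Pi =
    lookup⇒[]= i _ (trans (lookup∘tabulate (does ∘ P?) i) (dec-true (P? i) Pi))

  ∈-comprehension⁻ : ∀ {i} → i ∈ comprehension → P i
  ∈-comprehension⁻ {i} i∈ with P? i | trans (sym (lookup∘tabulate (does ∘ P?) i)) ([]=⇒lookup i∈)
  ... | yes Pi | _ = Pi

indicator : Bool → ℕ
indicator b = if b then 1 else 0

∣p∣≡∑indicator : ∀ {n} (p : Subset n) → ∣ p ∣ ≡ ∑[ i < n ] indicator (Vec.lookup p i)
∣p∣≡∑indicator Vec.[]            = refl
∣p∣≡∑indicator (true  Vec.∷ p)   = cong suc (∣p∣≡∑indicator p)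
∣p∣≡∑indicator (false Vec.∷ p)   = ∣p∣≡∑indicator p

∑-mono-≤ : ∀ {n} {f g : Fin n → ℕ} → (∀ i → f i ℕ.≤ g i) → sum f ℕ.≤ sum g
∑-mono-≤ {zero}  f≤g = z≤n
∑-mono-≤ {suc n} f≤g = ℕ.+-mono-≤ (f≤g zero) (∑-mono-≤ (f≤g ∘ suc))

∑-↑ : ∀ m {n} (f : Fin (m ℕ.+ n) → ℕ) →
      ∑[ i < m ℕ.+ n ] f i ≡ ∑[ i < m ] f (i ↑ˡ n) ℕ.+ ∑[ j < n ] f (m ↑ʳ j)
∑-↑ zero    f = refl
∑-↑ (suc m) f = trans (cong (f zero ℕ.+_) (∑-↑ m (f ∘ suc))) (sym (ℕ.+-assoc (f zero) _ _))

∑-combine : ∀ m {n} (f : Fin (m ℕ.* n) → ℕ) →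
            ∑[ k < m ℕ.* n ] f k ≡ ∑[ i < m ] ∑[ j < n ] f (combine i j)
∑-combine zero        f = refl
∑-combine (suc m) {n} f = trans (∑-↑ n f) (cong (∑[ j < n ] f (j ↑ˡ _) ℕ.+_) (∑-combine m (f ∘ (n ↑ʳ_))))

slice : ∀ m {n} → Subset (m ℕ.* n) → Fin n → Subset m
slice m p j = Vec.tabulate (λ i → Vec.lookup p (combine i j))

∈-slice⁺ : ∀ {m n} {p : Subset (m ℕ.* n)} {i : Fin m} {j} → combine i j ∈ p → i ∈ slice m p j
∈-slice⁺ {p = p} {i} {j} ij∈p = lookup⇒[]= i _
  (trans (lookup∘tabulate (λ i → Vec.lookup p (combine i j)) i) ([]=⇒lookup ij∈p))

-- Double counting: `p` splits into its slices, of which those over `q` contribute at least `s` each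
-- and the others at least 0.
slices≥⇒∣p∣≥ : ∀ m {n} (p : Subset (m ℕ.* n)) (q : Subset n) s →
                (∀ {j} → j ∈ q → s ℕ.≤ ∣ slice m p j ∣) → s ℕ.* ∣ q ∣ ℕ.≤ ∣ p ∣
slices≥⇒∣p∣≥ m {n} p q s s≤ = begin
  s ℕ.* ∣ q ∣                                                      ≡⟨ cong (s ℕ.*_) (∣p∣≡∑indicator q) ⟩
  s ℕ.* (∑[ j < n ] indicator (Vec.lookup q j))                    ≡⟨ *-distribˡ-sum {n} s _ ⟩
  ∑[ j < n ] (s ℕ.* indicator (Vec.lookup q j))                    ≤⟨ ∑-mono-≤ column ⟩
  ∑[ j < n ] ∣ slice m p j ∣                                       ≡⟨ sum-cong-≗ {n} ∣slice∣ ⟩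
  ∑[ j < n ] ∑[ i < m ] indicator (Vec.lookup p (combine i j))     ≡⟨ ∑-comm {n} {m} _ ⟩
  ∑[ i < m ] ∑[ j < n ] indicator (Vec.lookup p (combine i j))     ≡⟨ ∑-combine m _ ⟨
  ∑[ k < m ℕ.* n ] indicator (Vec.lookup p k)                      ≡⟨ ∣p∣≡∑indicator p ⟨
  ∣ p ∣                                                            ∎
  where
  open ℕ.≤-Reasoning

  column : ∀ j → s ℕ.* indicator (Vec.lookup q j) ℕ.≤ ∣ slice m p j ∣
  column j with Vec.lookup q j in eq
  ... | true  rewrite ℕ.*-identityʳ s = s≤ (lookup⇒[]= j q eq)
  ... | false rewrite ℕ.*-zeroʳ s     = z≤n

  ∣slice∣ : ∀ j → ∣ slice m p j ∣ ≡ ∑[ i < m ] indicator (Vec.lookup p (combine i j))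
  ∣slice∣ j = trans (∣p∣≡∑indicator (slice m p j))
    (sum-cong-≗ {m} λ i → cong indicator (lookup∘tabulate (λ i → Vec.lookup p (combine i j)) i))

-- The decomposition of H

module _ (G H : Graph) where

  fst-combine : ∀ g (h : Vertex H) → proj₁ (remQuot {order G} (order H) (combine g h)) ≡ g
  fst-combine g h = cong proj₁ (remQuot-combine g h)

  snd-combine : ∀ (g : Vertex G) h → proj₂ (remQuot {order G} (order H) (combine g h)) ≡ h
  snd-combine g h = cong proj₂ (remQuot-combine g h)

  □-adjˡ : ∀ {g g′ h} → Adj G g g′ → Adj (G □ H) (combine g h) (combine g′ h)
  □-adjˡ {g} {g′} {h} g~g′ = inj₂
    ( subst₂ (Adj G) (sym (fst-combine g h)) (sym (fst-combine g′ h)) g~g′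
    , trans (snd-combine g h) (sym (snd-combine g′ h)))

  □-adjʳ : ∀ {g h h′} → Adj H h h′ → Adj (G □ H) (combine g h) (combine g h′)
  □-adjʳ {g} {h} {h′} h~h′ = inj₁
    ( trans (fst-combine g h) (sym (fst-combine g h′))
    , subst₂ (Adj H) (sym (snd-combine g h)) (sym (snd-combine g h′)) h~h′)

-- The width plus one, kept in `ℕ` so that integers enter only in the final computation.
maxBag : ∀ {G} → TreeDecomposition G → ℕ
maxBag D = max 0 (tabulate (λ t → ∣ TreeDecomposition.bag D t ∣))

module _ (G H : Graph) (D : TreeDecomposition (G □ H)) (𝒮 : StrictBramble G) where
  open TreeDecomposition D
  open StrictBramble 𝒮 using (sets; intersect) renaming (connected to sets-connected)

  Meets : VertexSet G × Vertex H → Pred (Vertex tree) 0ℓ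
  Meets (A , h) t = ∃[ g ] (g ∈ A × combine g h ∈ bag t)

  meets? : ∀ Ah → Decidable (Meets Ah)
  meets? (A , h) t = any? λ g → (g ∈? A) ×-dec (combine g h ∈? bag t)

  -- Each edge of the walk in A lifts to the copy of G over `h`, and a bag covering the lifted edge
  -- links the subtrees of its two ends.
  meets-walk : ∀ {A h g g′ t t′} → Star (InducedAdj G (_∈ A)) g g′ → g ∈ A →
               combine g h ∈ bag t → combine g′ h ∈ bag t′ →
               Star (InducedAdj tree (Meets (A , h))) t t′
  meets-walk {g = g} ε g∈A gh∈t gh∈t′ =
    Star.map (λ (p , q , e) → (g , g∈A , p) , (g , g∈A , q) , e) (vertex-connected _ gh∈t gh∈t′)
  meets-walk ((_ , g₁∈A , e) ◅ es) g∈A gh∈t g′h∈t′ =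
    let t₁ , gh∈t₁ , g₁h∈t₁ = edge-covered (□-adjˡ G H e)
    in meets-walk ε g∈A gh∈t gh∈t₁ ◅◅ meets-walk es g₁∈A g₁h∈t₁ g′h∈t′

  meets-convex : ∀ {A h} → A List.∈ sets → Convex tree (Meets (A , h))
  meets-convex A∈ = connected⇒convex isTree (meets? _)
    λ (g , g∈A , gh∈t) (g′ , g′∈A , g′h∈t′) →
      meets-walk (sets-connected A∈ g∈A g′∈A) g∈A gh∈t g′h∈t′

  -- Equality is included so that one argument covers both the vertices and the edges of H.
  Near : Rel (Vertex H) 0ℓ
  Near h h′ = h ≡ h′ ⊎ Adj H h h′

  near-covered : ∀ {h h′} (g : Vertex G) → Near h h′ → ∃[ t ] (combine g h ∈ bag t × combine g h′ ∈ bag t)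
  near-covered g (inj₁ refl) = let t , gh∈t = vertex-covered _ in t , gh∈t , gh∈t
  near-covered g (inj₂ h~h′) = edge-covered (□-adjʳ G H h~h′)

  -- Strictness of the bramble enters here: if A and B were only joined by an edge `g g′`, then for
  -- adjacent `h` and `h′` the vertices (g , h) and (g′ , h′) would not be adjacent in the product
  -- and might share no bag.
  meets-intersect : ∀ {A B h h′} → A List.∈ sets → B List.∈ sets → Near h h′ →
                    ∃[ t ] (Meets (A , h) t × Meets (B , h′) t)
  meets-intersect {A} {B} A∈ B∈ h≈h′ =
    let g , g∈A∩B = intersect A∈ B∈
        g∈A , g∈B = x∈p∩q⁻ A B g∈A∩B
        t , gh∈t , gh′∈t = near-covered g h≈h′
    in t , (g , g∈A , gh∈t) , (g , g∈B , gh′∈t)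

  -- Read as an intersection of subtrees this gives convexity; read as "the slice of the bag over
  -- `h` hits 𝒮" it gives the count.
  Hits : Vertex H → Pred (Vertex tree) 0ℓ
  Hits h t = All (λ A → Meets (A , h) t) sets

  hits? : ∀ t → Decidable (λ h → Hits h t)
  hits? t h = All.all? (λ A → meets? (A , h) t) sets

  -- Helly for the subtrees of all A × {h} with `h` in `hs`. Cliques of one and two vertices yield
  -- the covering of vertices and edges of H.
  clique-hit : ∀ hs → (∀ {h h′} → h List.∈ hs → h′ List.∈ hs → Near h h′) →
               ∃[ t ] (∀ {h} → h List.∈ hs → Hits h t)
  clique-hit hs near =
    let t , _ , hit = helly isTree meets? {Q = U} (λ _ → yes tt)
          -- The intersection starts as the whole tree; its given node is the answer when there are
          -- no subtrees.
          (λ _ _ _ → All.universal (λ _ → tt) _) (IsTree.nonempty isTree , tt)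
          (cartesianProduct sets hs)
          (λ i∈ → meets-convex (proj₁ (split i∈)))
          -- Meeting the whole tree means being non-empty, which is the intersection property of a
          -- subtree with itself.
          (λ i∈ → let A∈ , h∈ = split i∈
                      t , m , _ = meets-intersect A∈ A∈ (near h∈ h∈)
                  in t , tt , m)
          (λ i∈ j∈ → let A∈ , h∈ = split i∈
                         B∈ , h′∈ = split j∈
                     in meets-intersect A∈ B∈ (near h∈ h′∈))
    in t , λ h∈ → All.tabulate λ A∈ → All.lookup hit (∈-cartesianProduct⁺ A∈ h∈)
    where
    split : ∀ {A h} → (A , h) List.∈ cartesianProduct sets hs → A List.∈ sets × h List.∈ hs
    split = ∈-cartesianProduct⁻ sets hs

  hits-convex : ∀ h → Convex tree (Hits h)
  hits-convex h p x y = All.tabulate λ t∈ → All.tabulate λ A∈ →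
    All.lookup (meets-convex A∈ p (All.lookup x A∈) (All.lookup y A∈)) t∈

  bramble-decomposition : TreeDecomposition H
  bramble-decomposition = record
    { tree             = tree
    ; isTree           = isTree
    ; bag              = λ t → comprehension (hits? t)
    ; vertex-covered   = λ h →
        let t , hit = clique-hit (h ∷ []) λ { (here refl) (here refl) → inj₁ refl }
        in t , ∈-comprehension⁺ (hits? t) (hit (here refl))
    ; vertex-connected = λ h {t} {t′} h∈t h∈t′ →
        Star.map (λ {t} {t′} (p , q , e) →
            ∈-comprehension⁺ (hits? t) p , ∈-comprehension⁺ (hits? t′) q , e)
          (convex⇒connected isTree (hits-convex h)
            (∈-comprehension⁻ (hits? t) h∈t) (∈-comprehension⁻ (hits? t′) h∈t′))
    ; edge-covered     = λ {h} {h′} h~h′ →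
        let t , hit = clique-hit (h ∷ h′ ∷ []) λ where
              (here refl)         (here refl)         → inj₁ refl
              (here refl)         (there (here refl)) → inj₂ h~h′
              (there (here refl)) (here refl)         → inj₂ (adj-sym H h~h′)
              (there (here refl)) (there (here refl)) → inj₁ refl
        in t , ∈-comprehension⁺ (hits? t) (hit (here refl))
             , ∈-comprehension⁺ (hits? t) (hit (there (here refl)))
    }

  -- Over each `h` in the new bag, the slice of the old bag is a hitting set, hence has at least `s`
  -- elements.
  bag-size : ∀ {s} → IsBrambleOrder 𝒮 s → ∀ t →
             s ℕ.* ∣ TreeDecomposition.bag bramble-decomposition t ∣ ℕ.≤ ∣ bag t ∣
  bag-size {s} (_ , s≤) t = slices≥⇒∣p∣≥ (order G) (bag t) _ s λ {h} h∈t →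
    s≤ (slice (order G) (bag t) h , hitting h∈t , refl)
    where
    hitting : ∀ {h} → h ∈ comprehension (hits? t) → IsHittingSet 𝒮 (slice (order G) (bag t) h)
    hitting h∈t A∈ =
      let g , g∈A , gh∈t = All.lookup (∈-comprehension⁻ (hits? t) h∈t) A∈
      in g , x∈p∩q⁺ (∈-slice⁺ {p = bag t} gh∈t , g∈A)

  maxBag-size : ∀ {s} → IsBrambleOrder 𝒮 s → s ℕ.* maxBag bramble-decomposition ℕ.≤ maxBag D
  maxBag-size {s} ord = argmax-all id {P = λ k → s ℕ.* k ℕ.≤ maxBag D}
    -- The default value 0 of `max`.
    (subst (ℕ._≤ maxBag D) (sym (ℕ.*-zeroʳ s)) z≤n)
    (All.tabulate⁺ λ t → ℕ.≤-trans (bag-size ord t) (All.tabulate⁻ (xs≤max 0 _) t))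

theorem7 : (G H : Graph) (s : ℕ) (twH twG□H : ℤ) →
    IsStrictBrambleNumber G s →
    IsTreewidth H twH →
    IsTreewidth (G □ H) twG□H →
    twG□H ≥ + s * (twH + 1ℤ) - 1ℤ
theorem7 G H s twH twG□H ((𝒮 , ord) , _) (_ , twH≤) ((D , refl) , _) =
  -- `D` attains tw(G □ H) and `𝒮` attains sbn(G), while `D′` bounds `twH` from above by m - 1.
  ℤ.+-monoˡ-≤ (ℤ.- 1ℤ) (begin
    + s * (twH + 1ℤ)          ≤⟨ ℤ.*-monoˡ-≤-nonNeg (+ s) (ℤ.+-monoˡ-≤ 1ℤ (twH≤ (D′ , refl))) ⟩
    + s * (+ m - 1ℤ + 1ℤ)     ≡⟨ cong (+ s *_) (trans (ℤ.+-assoc (+ m) (ℤ.- 1ℤ) 1ℤ) (ℤ.+-identityʳ (+ m))) ⟩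
    + s * + m                 ≡⟨ ℤ.pos-* s m ⟨
    + (s ℕ.* m)               ≤⟨ ℤ.+≤+ (maxBag-size G H D 𝒮 ord) ⟩
    + maxBag D            ∎)
  where
  open ℤ.≤-Reasoning
  D′ = bramble-decomposition G H D 𝒮
  m = maxBag D′
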